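{- Let $r\ge 4$ be an integer. The side-length triples $(r,s,t)$, with first entry the given $r$, of triangles associated with $D(4)$-triples are exactly the triples $$(r,s,t)=(r,\,r+a,\,r+b),$$ where $a,b$ are positive integers satisfying $$r^2-4=ab,\qquad 0<a<b,\qquad b-a<r.$$ The corresponding $D(4)$-triple is uniquely determined and is $\{a,b,a+b+2r\}$.
   Context: A $D(4)$-triple is a set of three distinct positive integers such that the product of any two distinct elements, increased by $4$, is a perfect square. For a $D(4)$-triple $\{a,b,c\}$ with $a<b<c$, put $r=\sqrt{ab+4}$, $s=\sqrt{ac+4}$, $t=\sqrt{bc+4}$; these are positive integers with $r<s<t$. If $r+s>t$, the (non-degenerate) triangle with side lengths $r,s,t$ is called the triangle associated with the $D(4)$-triple $\{a,b,c\}$, and $(r,s,t)$ (in this increasing order) is its side-length triple; if $r+s\le t$, no triangle is associated with $\{a,b,c\}$. -}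

module Defs where

open import Data.Nat using (ℕ; _+_; _*_; _∸_; _^_; _<_)
open import Data.Product using (_×_; ∃; ∃-syntax)
open import Level using (0ℓ)
open import Relation.Binary.PropositionalEquality using (_≡_; _≢_)
open import Relation.Unary using (Pred; _∈_; _≐_; ｛_｝; _∪_)

IsPerfectSquare : ℕ → Set
IsPerfectSquare n = ∃[ k ] k ^ 2 ≡ n

⟦_,_,_⟧ : ℕ → ℕ → ℕ → Pred ℕ 0ℓ
⟦ a , b , c ⟧ = ｛ a ｝ ∪ ｛ b ｝ ∪ ｛ c ｝

-- Sets of natural numbers are predicates, and they are compared by
-- extensional equality _≐_.
record IsD4Triple (D : Pred ℕ 0ℓ) : Set where
  field
    threeElements : ∃[ x ] ∃[ y ] ∃[ z ]
                      (x ≢ y × x ≢ z × y ≢ z × D ≐ ⟦ x , y , z ⟧)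
    positive      : ∀ x → x ∈ D → 0 < x
    square        : ∀ x y → x ∈ D → y ∈ D → x ≢ y →
                      IsPerfectSquare (x * y + 4)

-- The D(4)-triple D has an associated triangle, with side-length triple
-- (r , s , t).  A natural number whose square is n is √n, so the three
-- equations say r = √(ab+4), s = √(ac+4), t = √(bc+4); they also force
-- 0 < r < s < t, so t < r + s is the only triangle inequality needed.
record HasAssociatedTriangle (D : Pred ℕ 0ℓ) (r s t : ℕ) : Set where
  field
    isD4Triple : IsD4Triple D
    a b c      : ℕ
    elements   : D ≐ ⟦ a , b , c ⟧
    a<b        : a < b
    b<c        : b < c
    r-root     : r ^ 2 ≡ a * b + 4
    s-root     : s ^ 2 ≡ a * c + 4
    t-root     : t ^ 2 ≡ b * c + 4
    triangle   : t < r + s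

IsSideLengthTriple : ℕ → ℕ → ℕ → Set₁
IsSideLengthTriple r s t = ∃ λ (D : Pred ℕ 0ℓ) → HasAssociatedTriangle D r s t

-- Both uses of ∸ are genuine subtractions: 4 ≤ r ^ 2 whenever 2 ≤ r
-- (the case of interest is 4 ≤ r), and a < b is assumed.
record IsAdmissible (r a b : ℕ) : Set where
  field
    factorisation : r ^ 2 ∸ 4 ≡ a * b
    0<a           : 0 < a
    a<b           : a < b
    b-a<r         : b ∸ a < r

{-# OPTIONS --safe #-}
module Submission where

-- A D(4)-triple a < b < c descends to (a , b , e), where e ≥ 0 and, with
-- x = √(ae+4) and y = √(be+4), 2s = ay + rx and 2t = bx + ry.  If e = 0 then
-- x = y = 2, so s = r + a, t = r + b and c = a + b + 2r.  If e > 0 then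
-- t ≥ r + s: writing q = r − a and p = b − r, this is 2r ≤ px + qy.  For e ≥ b
-- it holds because x, y ≥ r and p + q ≥ 2.  For e < b a second descent, from b
-- as largest element, gives r ≥ a + x, that is q ≥ x, while p > q and y > x;
-- the claim then follows from x² ≥ a + 4.  The only case with b = a + 1 is
-- (a , b) = (3 , 4), where y ≥ 8 = 2r.

open import Defs
open import Data.Nat using (ℕ; zero; suc; _+_; _*_; _∸_; _^_; _≤_; _<_; s≤s; z≤n; s≤s⁻¹; >-nonZero)
open import Data.Nat.Divisibility using (_∣_; divides; ∣m+n∣m⇒∣n)
open import Data.Nat.Primality using (euclidsLemma; prime[2])
open import Data.Nat.Properties
open import Data.Nat.Tactic.RingSolver using (solve; solve-∀)
open import Data.List.Base using ([]; _∷_)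
open import Data.Product using (_×_; ∃-syntax; _,_; proj₁; proj₂)
open import Data.Sum using (_⊎_; inj₁; inj₂; [_,_]′)
open import Function.Base using (id; _∘_)
open import Function.Bundles using (_⇔_; mk⇔)
open import Level using (0ℓ)
open import Relation.Binary.PropositionalEquality
open import Relation.Nullary using (yes; no; contradiction)
open import Relation.Nullary.Decidable using (from-yes; from-no; ¬?; _→-dec_)
open import Relation.Unary using (Pred; _≐_)

-- An (in)equality is deduced from a sum of known ones, o ≡ p or o ≤ p, by a
-- semiring identity whose sides are arranged so that no subtraction occurs.
combine-≡ : ∀ {m n o p} → o ≡ p → m + p ≡ n + o → m ≡ n
combine-≡ {m} {n} {o} refl eq = +-cancelʳ-≡ o m n eq

combine-≤ : ∀ {m n o p} k → o ≤ p → m + p + k ≡ n + o → m ≤ n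
combine-≤ {m} {n} {o} {p} k o≤p eq = +-cancelʳ-≤ o m n (begin
  m + o      ≤⟨ +-monoʳ-≤ m o≤p ⟩
  m + p      ≤⟨ m≤m+n (m + p) k ⟩
  m + p + k  ≡⟨ eq ⟩
  n + o      ∎)
  where open ≤-Reasoning

square-cancel-< : ∀ {m n} → m * m < n * n → m < n
square-cancel-< m²<n² = ≰⇒> λ n≤m → <⇒≱ m²<n² (*-mono-≤ n≤m n≤m)

square-cancel-≤ : ∀ {m n} → m * m ≤ n * n → m ≤ n
square-cancel-≤ m²≤n² = ≮⇒≥ λ n<m → ≤⇒≯ m²≤n² (*-mono-< n<m n<m)

-- A record rather than a bare equation, so that `a`, `b` and `r` can be inferred from the type of a
-- root.
record IsRoot (a b r : ℕ) : Set where
  constructor isRoot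
  field squared : r * r ≡ a * b + 4
open IsRoot

isRoot-comm : ∀ {a b r} → IsRoot a b r → IsRoot b a r
isRoot-comm {a} {b} (isRoot eq) = isRoot (trans eq (cong (_+ 4) (*-comm a b)))

even-square : ∀ {k} → 2 ∣ k * k → 2 ∣ k
even-square {k} = [ id , id ]′ ∘ euclidsLemma k k prime[2]

rootProduct² : ∀ {a b c d r s} → IsRoot a b r → IsRoot c d s →
  r * s * (r * s) ≡ (a * b + 4) * (c * d + 4)
rootProduct² {r = r} {s} R S =
  trans ([m*n]*[o*p]≡[m*o]*[n*p] r s r s) (cong₂ _*_ (squared R) (squared S))

multipleOfRoot² : ∀ a {b c t} → IsRoot b c t → a * t * (a * t) ≡ a * a * (b * c + 4)
multipleOfRoot² a {t = t} T = trans ([m*n]*[o*p]≡[m*o]*[n*p] a t a t) (cong (a * a *_) (squared T))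

-- Descent from the largest element

at<rs : ∀ {a b c r s t} → a ≤ c → IsRoot a b r → IsRoot a c s → IsRoot b c t → a * t < r * s
at<rs {a} {b} a≤c R S T with d , refl ← m≤n⇒∃[o]m+o≡n a≤c =
  square-cancel-< (subst₂ _<_ (sym (multipleOfRoot² a T)) (sym (rootProduct² R S))
    (combine-≤ {o = 0} {0} (4 * a * b + 4 * a * d + 15) z≤n (solve (a ∷ b ∷ d ∷ []))))

-- The difference k = rs - at satisfies k² + 2atk + 4a² = 4(a(b + c) + 4). Hence k² is even, so k =
-- 2x, and division by 4 leaves the equation for x.
halfDifference : ∀ {a b c r s t} → a ≤ c → IsRoot a b r → IsRoot a c s → IsRoot b c t →
  ∃[ x ] (0 < x × r * s ≡ a * t + 2 * x × x * x + a * t * x + a * a ≡ a * (b + c) + 4)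
halfDifference {a} {b} {c} {r} {s} {t} a≤c R S T
  with j , eq ← m≤n⇒∃[o]m+o≡n (at<rs a≤c R S T)
  = evenDifference (suc j) (s≤s z≤n) (trans (sym eq) (sym (+-suc (a * t) j)))
  where
  halve : ∀ x → 0 < x * 2 → r * s ≡ a * t + x * 2 →
    x * 2 * (x * 2) + (2 * (a * t * (x * 2)) + 4 * (a * a)) ≡ 4 * (a * (b + c) + 4) → _
  halve x 0<2x rs≡ eq =
    x , *-cancelʳ-< 2 0 x 0<2x , trans rs≡ (cong (a * t +_) (*-comm x 2)) ,
    *-cancelˡ-≡ _ _ 4 (trans expand eq)
    where
    expand : 4 * (x * x + a * t * x + a * a) ≡
      x * 2 * (x * 2) + (2 * (a * t * (x * 2)) + 4 * (a * a))
    expand = solve (a ∷ t ∷ x ∷ [])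
  evenDifference : ∀ k → 0 < k → r * s ≡ a * t + k → _
  evenDifference k 0<k rs≡ = halveEven (even-square 2∣k²)
    where
    k-eq : k * k + (2 * (a * t * k) + 4 * (a * a)) ≡ 4 * (a * (b + c) + 4)
    k-eq = combine-≡
      (cong₂ _+_ (trans (sym (cong₂ _*_ rs≡ rs≡)) (rootProduct² R S)) (sym (multipleOfRoot² a T)))
      (solve (a ∷ b ∷ c ∷ t ∷ k ∷ []))
    factor : 4 * (a * (b + c) + 4) ≡ 2 * (a * (b + c) + 4) * 2
    factor = solve (a ∷ b ∷ c ∷ [])
    factor′ : 2 * (a * t * k) + 4 * (a * a) ≡ (a * t * k + 2 * (a * a)) * 2
    factor′ = solve (a ∷ t ∷ k ∷ [])
    2∣k² : 2 ∣ k * k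
    2∣k² = ∣m+n∣m⇒∣n
      (divides (2 * (a * (b + c) + 4)) (trans (+-comm _ (k * k)) (trans k-eq factor)))
      (divides (a * t * k + 2 * (a * a)) factor′)
    halveEven : 2 ∣ k → _
    halveEven (divides x k≡x*2) = halve x
      (subst (0 <_) k≡x*2 0<k) (subst (λ k → r * s ≡ a * t + k) k≡x*2 rs≡)
      (subst (λ k → k * k + (2 * (a * t * k) + 4 * (a * a)) ≡ 4 * (a * (b + c) + 4)) k≡x*2 k-eq)

-- This makes e = a + c - b - sy a natural number. If sy + b exceeded a + c, multiplying by b and
-- using the equation would give y² + b ≤ 4, against y ≥ 1 and b ≥ 4.
remainder-bound : ∀ {a b c s y} → 4 ≤ b → 0 < y →
  y * y + b * s * y + b * b ≡ b * (a + c) + 4 → s * y + b ≤ a + c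
remainder-bound {a} {b} {c} {s} {y} 4≤b 0<y y-eq = ≮⇒≥ λ a+c<sy+b → <⇒≱ (b<4 a+c<sy+b) 4≤b
  where
  y²≥1 : 1 ≤ y * y
  y²≥1 = *-mono-≤ 0<y 0<y
  b<4 : a + c < s * y + b → b < 4
  b<4 a+c<sy+b = combine-≤ 0 (+-mono-≤ (+-mono-≤ scaled (≤-reflexive y-eq)) y²≥1)
    (solve (a ∷ b ∷ c ∷ s ∷ y ∷ []))
    where
    scaled : b * (1 + (a + c)) ≤ b * (s * y + b)
    scaled = *-monoʳ-≤ b a+c<sy+b

-- From a third element c we pass to e such that (a , b , e) is again
-- of the same kind: 2 x = r s − a t, 2 y = r t − b s, and
-- e = a + c − b − s y = b + c − a − t x = a + b + c + (a b c − r s t) / 2.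
module _ {a b c r s t} (a≤c : a ≤ c) (b≤c : b ≤ c) (4≤b : 4 ≤ b)
  (R : IsRoot a b r) (S : IsRoot a c s) (T : IsRoot b c t) where

  Descent : Set
  Descent = ∃[ e ] ∃[ x ] ∃[ y ] (IsRoot a e x × IsRoot b e y ×
    2 * s ≡ a * y + r * x × 2 * t ≡ b * x + r * y)

  private
    module Quotient {x y e}
      (rs≡ : r * s ≡ a * t + 2 * x) (x-eq : x * x + a * t * x + a * a ≡ a * (b + c) + 4)
      (rt≡ : r * t ≡ b * s + 2 * y) (y-eq : y * y + b * s * y + b * b ≡ b * (a + c) + 4)
      (e-eq : s * y + b + e ≡ a + c) where

      -- r(rs - at) + a(rt - bs) = (r² - ab)s = 4s; exchanging the roles of a and b gives 4t.
      4s≡ : 2 * (2 * s) ≡ 2 * (a * y + r * x)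
      4s≡ = combine-≡
        (cong₂ _+_ (cong₂ _+_ (cong (s *_) (sym (squared R))) (cong (r *_) rs≡)) (cong (a *_) rt≡))
        (solve (a ∷ b ∷ r ∷ s ∷ t ∷ x ∷ y ∷ []))

      4t≡ : 2 * (2 * t) ≡ 2 * (b * x + r * y)
      4t≡ = combine-≡
        (cong₂ _+_ (cong₂ _+_ (cong (t *_) (sym (squared R))) (cong (r *_) rt≡)) (cong (b *_) rs≡))
        (solve (a ∷ b ∷ r ∷ s ∷ t ∷ x ∷ y ∷ []))

      y²≡ : y * y ≡ b * e + 4
      y²≡ = combine-≡ (cong₂ _+_ y-eq (cong (b *_) (sym e-eq)))
        (solve (a ∷ b ∷ c ∷ e ∷ s ∷ y ∷ []))

      -- Both sides equal rst - abc, so the two formulas for e agree.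
      2tx≡ : 2 * (t * x) + 4 * a ≡ 2 * (s * y) + 4 * b
      2tx≡ = combine-≡
        (cong₂ _+_ (cong₂ _+_ (cong (t *_) (sym rs≡)) (cong (s *_) rt≡))
                   (cong₂ _+_ (cong (a *_) (sym (squared T))) (cong (b *_) (squared S))))
        (solve (a ∷ b ∷ c ∷ r ∷ s ∷ t ∷ x ∷ y ∷ []))

      x²≡ : x * x ≡ a * e + 4
      x²≡ = *-cancelˡ-≡ (x * x) (a * e + 4) 2 (combine-≡
        (cong₂ _+_ (cong₂ _+_ (cong (2 *_) x-eq) (cong (2 * a *_) (sym e-eq))) (cong (a *_) (sym 2tx≡)))
        (solve (a ∷ b ∷ c ∷ e ∷ s ∷ t ∷ x ∷ y ∷ [])))

      result : Descent
      result = e , x , y , isRoot x²≡ , isRoot y²≡ ,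
        *-cancelˡ-≡ (2 * s) (a * y + r * x) 2 4s≡ , *-cancelˡ-≡ (2 * t) (b * x + r * y) 2 4t≡

  -- Abstract, because a with on descent would otherwise normalise the ring-solver proofs.
  abstract
    descent : Descent
    descent =
      let x , _   , rs≡ , x-eq = halfDifference a≤c R S T
          y , 0<y , rt≡ , y-eq = halfDifference b≤c (isRoot-comm R) T S
          e , e-eq = m≤n⇒∃[o]m+o≡n (remainder-bound {a} {b} {c} {s} {y} 4≤b 0<y y-eq)
      in Quotient.result rs≡ x-eq rt≡ y-eq e-eq

-- Bounds on roots

root≥2 : ∀ {a b r} → IsRoot a b r → 2 ≤ r
root≥2 {a} {b} R = square-cancel-≤ (subst (4 ≤_) (sym (squared R)) (m≤n+m 4 (a * b)))

root-mono-≤ : ∀ {a b c d r s} → a ≤ c → b ≤ d → IsRoot a b r → IsRoot c d s → r ≤ s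
root-mono-≤ a≤c b≤d R S = square-cancel-≤
  (subst₂ _≤_ (sym (squared R)) (sym (squared S)) (+-monoˡ-≤ 4 (*-mono-≤ a≤c b≤d)))

root-mono-< : ∀ {a b e x y} → a < b → 0 < e → IsRoot a e x → IsRoot b e y → x < y
root-mono-< {e = suc _} a<b 0<e X Y = square-cancel-<
  (subst₂ _<_ (sym (squared X)) (sym (squared Y)) (+-monoˡ-< 4 (*-monoˡ-< _ a<b)))

-- Descent gives 2s = ay + rx with x, y ≥ 2. It may start from either of a and b, whichever is at
-- least 4.
gap : ∀ {a b c r s t} → a ≤ c → b ≤ c → 4 ≤ a ⊎ 4 ≤ b →
  IsRoot a b r → IsRoot a c s → IsRoot b c t → a + r ≤ s
gap {a} {b} {c} {r} {s} {t} a≤c b≤c 4≤a⊎4≤b R S T = *-cancelˡ-≤ 2 (doubled 4≤a⊎4≤b)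
  where
  bound : ∀ {x y} → 2 ≤ x → 2 ≤ y → 2 * s ≡ a * y + r * x → 2 * (a + r) ≤ 2 * s
  bound {x} {y} 2≤x 2≤y 2s≡ = begin
    2 * (a + r)    ≡⟨ solve (a ∷ r ∷ []) ⟩
    a * 2 + r * 2  ≤⟨ +-mono-≤ (*-monoʳ-≤ a 2≤y) (*-monoʳ-≤ r 2≤x) ⟩
    a * y + r * x  ≡⟨ 2s≡ ⟨
    2 * s          ∎
    where open ≤-Reasoning
  doubled : 4 ≤ a ⊎ 4 ≤ b → 2 * (a + r) ≤ 2 * s
  doubled (inj₂ 4≤b) with e , x , y , X , Y , 2s≡ , _ ← descent a≤c b≤c 4≤b R S T =
    bound (root≥2 X) (root≥2 Y) 2s≡
  doubled (inj₁ 4≤a) with e , y , x , Y , X , _ , 2s≡ ← descent b≤c a≤c 4≤a (isRoot-comm R) T S =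
    bound (root≥2 X) (root≥2 Y) 2s≡

-- Small and consecutive factors

no-small-roots : ∀ {a} → a < 3 → ∀ {b} → b < 3 → ∀ {r} → r < 4 → r * r ≢ suc a * suc b + 4
no-small-roots = from-yes (allUpTo? (λ a → allUpTo? (λ b → allUpTo? (λ r →
  ¬? (r * r ≟ suc a * suc b + 4)) 4) 3) 3)

root-of-positive>2 : ∀ {a b r} → 0 < a → 0 < b → IsRoot a b r → 3 ≤ r
root-of-positive>2 0<a 0<b R = square-cancel-<
  (subst (4 <_) (sym (squared R)) (+-monoˡ-≤ 4 (*-mono-≤ 0<a 0<b)))

-- If both factors are at most 3, then r² ≤ 13, so r < 4 and a finite check applies.
large-factor : ∀ {a b r} → 0 < a → 0 < b → IsRoot a b r → 4 ≤ a ⊎ 4 ≤ b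
large-factor {suc a} {suc b} {r} _ _ R with 3 ≤? a | 3 ≤? b
... | yes 3≤a | _       = inj₁ (s≤s 3≤a)
... | no _    | yes 3≤b = inj₂ (s≤s 3≤b)
... | no 3≰a  | no 3≰b  = contradiction (squared R) (no-small-roots a<3 b<3 r<4)
  where
  a<3 = ≰⇒> 3≰a
  b<3 = ≰⇒> 3≰b
  r<4 : r < 4
  r<4 = square-cancel-< (subst (_< 16) (sym (squared R))
    (s≤s (≤-trans (+-monoˡ-≤ 4 (*-mono-≤ a<3 b<3)) (m≤m+n 13 2))))

-- For a ≥ 4 the number a(a + 1) + 4 lies strictly between a² and (a + 1)²; for a ≤ 2 it is below 16
-- ≤ r².
consecutive-factors : ∀ {a r} → 4 ≤ r → IsRoot a (suc a) r → a ≡ 3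
consecutive-factors {a} 4≤r R with ≤-<-connex 16 (a * suc a + 4)
... | inj₂ small = contradiction small (≤⇒≯ (subst (16 ≤_) (squared R) (*-mono-≤ 4≤r 4≤r)))
consecutive-factors {0} 4≤r R | inj₁ 16≤ = contradiction 16≤ (from-no (16 ≤? 4))
consecutive-factors {1} 4≤r R | inj₁ 16≤ = contradiction 16≤ (from-no (16 ≤? 6))
consecutive-factors {2} 4≤r R | inj₁ 16≤ = contradiction 16≤ (from-no (16 ≤? 10))
consecutive-factors {3} 4≤r R | inj₁ _ = refl
consecutive-factors {a@(suc (suc (suc (suc d))))} {r} 4≤r R | inj₁ _ =
  contradiction a<r (≤⇒≯ r≤a)
  where
  a<r : a < r
  a<r = square-cancel-< (subst (a * a <_) (sym (squared R))
    (combine-≤ {o = 0} {0} (d + 7) z≤n (solve (d ∷ []))))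
  r≤a : r ≤ a
  r≤a = s≤s⁻¹ (square-cancel-< (subst (_< suc a * suc a) (sym (squared R))
    (combine-≤ {o = 0} {0} d z≤n (solve (d ∷ [])))))

small-pell-solutions : ∀ {y} → y < 8 → ∀ {x} → x < 8 → 4 * (x * x) ≡ 3 * (y * y) + 4 → y ≤ 2
small-pell-solutions = from-yes (allUpTo? (λ y → allUpTo? (λ x →
  (4 * (x * x) ≟ 3 * (y * y) + 4) →-dec (y ≤? 2)) 8) 8)

-- Eliminating e gives 4x² - 3y² = 4. With y < 8, and hence x < 8, a finite check leaves only y ≤ 2,
-- but e > 0 forces y ≥ 3.
extension-of-3-4 : ∀ {e x y} → 0 < e → IsRoot 3 e x → IsRoot 4 e y → 8 ≤ y
extension-of-3-4 {e} {x} {y} 0<e X Y = ≮⇒≥ λ y<8 →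
  contradiction (root-of-positive>2 {4} (s≤s z≤n) 0<e Y)
    (≤⇒≯ (small-pell-solutions y<8 (<-trans (root-mono-< ≤-refl 0<e X Y) y<8) pell))
  where
  pell : 4 * (x * x) ≡ 3 * (y * y) + 4
  pell = combine-≡ (cong₂ _+_ (cong (4 *_) (squared X)) (cong (3 *_) (sym (squared Y))))
    (solve (e ∷ x ∷ y ∷ []))

-- Failure of the triangle inequality for positive e

-- px + qy ≥ (q + 1)x + q(x + 1) = 2qx + x + q, and 2(a + q) ≤ 2(x² - 4 + q). The two bounds differ
-- by (2x - 1)(q - x) + 8 > 0.
weighted-sum-bound : ∀ {a p q x y} → a + 4 ≤ x * x → 3 ≤ x → x ≤ q → q < p → x < y →
  2 * (a + q) ≤ p * x + q * y
weighted-sum-bound {a} a+4≤x² 3≤x x≤q q<p x<y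
  with w , refl ← m≤n⇒∃[o]m+o≡n 3≤x
  with i , refl ← m≤n⇒∃[o]m+o≡n x≤q
  with j , refl ← m≤n⇒∃[o]m+o≡n q<p
  with k , refl ← m≤n⇒∃[o]m+o≡n x<y =
  combine-≤ (5 * i + 2 * i * w + (3 + w) * j + (3 + w) * k + i * k + 8)
    (*-monoʳ-≤ 2 a+4≤x²) (identity a w i j k)
  where
  identity : ∀ a w i j k →
    2 * (a + (3 + w + i)) + 2 * ((3 + w) * (3 + w)) +
      (5 * i + 2 * i * w + (3 + w) * j + (3 + w) * k + i * k + 8) ≡
    (1 + (3 + w + i) + j) * (3 + w) + (3 + w + i) * (1 + (3 + w) + k) + 2 * (a + 4)
  identity = solve-∀

-- The root equation reduces to a(p - q) = q² - 4, which is positive for q ≥ 3.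
smaller-complement : ∀ {a p q} → 3 ≤ q → IsRoot a (a + q + p) (a + q) → q < p
smaller-complement {a} {p} {q} 3≤q R = *-cancelˡ-< a q p (combine-≤ 4
  (+-mono-≤ (≤-reflexive (squared R)) (*-mono-≤ 3≤q 3≤q)) (solve (a ∷ p ∷ q ∷ [])))

-- By the formulas of descent the two sides are 2 (r + s) and 2 t.
noTriangle-separated : ∀ {a b e r x y} → 0 < a → 2 + a ≤ b → 0 < e →
  IsRoot a b r → IsRoot a e x → IsRoot b e y → 2 * r + (a * y + r * x) ≤ b * x + r * y
noTriangle-separated {a} {b} {e} {r} {x} {y} 0<a 2+a≤b 0<e R X Y = separate a≤r r≤b
  where
  a≤b : a ≤ b
  a≤b = ≤-trans (m≤n+m a 2) 2+a≤b
  a≤r : a ≤ r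
  a≤r = square-cancel-≤ (subst (a * a ≤_) (sym (squared R))
    (≤-trans (*-monoʳ-≤ a a≤b) (m≤m+n (a * b) 4)))
  r≤b : r ≤ b
  r≤b = square-cancel-≤ (subst (_≤ b * b) (sym (squared R)) ab+4≤b²)
    where
    4≤2b : 2 * 2 ≤ 2 * b
    4≤2b = *-monoʳ-≤ 2 (≤-trans (m≤m+n 2 a) 2+a≤b)
    [2+a]b≤b² : (2 + a) * b ≤ b * b
    [2+a]b≤b² = *-monoˡ-≤ b 2+a≤b
    ab+4≤b² : a * b + 4 ≤ b * b
    ab+4≤b² = combine-≤ 0 (+-mono-≤ [2+a]b≤b² 4≤2b) (solve (a ∷ b ∷ []))
  key : ∀ {p q} → a + q ≡ r → a + q + p ≡ b → 2 * (a + q) ≤ p * x + q * y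
  key {p} {q} refl refl with b ≤? e
  ... | yes b≤e = begin
    2 * r          ≤⟨ *-monoˡ-≤ r 2≤p+q ⟩
    (p + q) * r    ≡⟨ *-distribʳ-+ r p q ⟩
    p * r + q * r  ≤⟨ +-mono-≤ (*-monoʳ-≤ p (root-mono-≤ ≤-refl b≤e R X))
                               (*-monoʳ-≤ q (root-mono-≤ a≤b b≤e R Y)) ⟩
    p * x + q * y  ∎
    where
    open ≤-Reasoning
    2≤p+q : 2 ≤ p + q
    2≤p+q = combine-≤ 0 2+a≤b (solve (a ∷ p ∷ q ∷ []))
  ... | no b≰e =
    weighted-sum-bound a+4≤x² 3≤x x≤q (smaller-complement (≤-trans 3≤x x≤q) R)
      (root-mono-< (≤-trans (n≤1+n (suc a)) 2+a≤b) 0<e X Y)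
    where
    3≤x : 3 ≤ x
    3≤x = root-of-positive>2 0<a 0<e X
    x≤q : x ≤ q
    -- As e < b, the largest of a, e, b is b; `gap` then gives a + x ≤ r = a + q.
    x≤q = +-cancelˡ-≤ a x q (gap a≤b (<⇒≤ (≰⇒> b≰e)) (large-factor 0<a 0<e X) X R (isRoot-comm Y))
    a+4≤x² : a + 4 ≤ x * x
    a+4≤x² = subst (a + 4 ≤_) (sym (squared X))
      (+-monoˡ-≤ 4 (subst (_≤ a * e) (*-identityʳ a) (*-monoʳ-≤ a 0<e)))
  separate : a ≤ r → r ≤ b → 2 * r + (a * y + r * x) ≤ b * x + r * y
  separate a≤r r≤b
    with q , refl ← m≤n⇒∃[o]m+o≡n a≤r
    with p , refl ← m≤n⇒∃[o]m+o≡n r≤b =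
    combine-≤ 0 (key {p} {q} refl refl) (solve (a ∷ p ∷ q ∷ x ∷ y ∷ []))

noTriangle : ∀ {a b e r x y} → 0 < a → a < b → 4 ≤ r → 0 < e →
  IsRoot a b r → IsRoot a e x → IsRoot b e y → 2 * r + (a * y + r * x) ≤ b * x + r * y
noTriangle {a} {b} {e} {r} {x} {y} 0<a a<b 4≤r 0<e R X Y with m≤n⇒m<n∨m≡n a<b
... | inj₁ 2+a≤b = noTriangle-separated 0<a 2+a≤b 0<e R X Y
... | inj₂ refl with refl ← consecutive-factors 4≤r R
                with refl ← ≤-antisym (square-cancel-≤ (≤-reflexive (squared R))) 4≤r =
  -- With (a, b, r) = (3, 4, 4) the claim 8 + 3y + 4x ≤ 4x + 4y is just 8 ≤ y.
  combine-≤ 0 (extension-of-3-4 0<e X Y) (solve (x ∷ y ∷ []))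

-- Supplies the bound that `descent` requires: b ≤ 3 would give ab + 4 ≤ 13 < 16 ≤ r².
larger-factor≥4 : ∀ {a b r} → a < b → 4 ≤ r → IsRoot a b r → 4 ≤ b
larger-factor≥4 {a} {b} {r} a<b 4≤r R = ≮⇒≥ λ b<4 →
  <⇒≱ (s≤s (+-monoˡ-≤ 4 (*-mono-≤ (<⇒≤ (<-≤-trans a<b (s≤s⁻¹ b<4))) (s≤s⁻¹ b<4))))
    (≤-trans (m≤n+m 14 2) (subst (16 ≤_) (squared R) (*-mono-≤ 4≤r 4≤r)))

root-of-zero : ∀ {a r} → IsRoot a 0 r → r ≡ 2
root-of-zero {a} R = ≤-antisym
  (square-cancel-≤ (≤-reflexive (trans (squared R) (cong (_+ 4) (*-zeroʳ a))))) (root≥2 R)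

triangle-sides : ∀ {a b c r s t} → 0 < a → a < b → b < c → 4 ≤ r →
  IsRoot a b r → IsRoot a c s → IsRoot b c t → t < r + s → s ≡ r + a × t ≡ r + b
triangle-sides {a} {b} {c} {r} {s} {t} 0<a a<b b<c 4≤r R S T t<r+s
  with descent (<⇒≤ (<-trans a<b b<c)) (<⇒≤ b<c) (larger-factor≥4 a<b 4≤r R) R S T
... | zero , x , y , X , Y , 2s≡ , 2t≡
  with refl ← root-of-zero X | refl ← root-of-zero Y =
  *-cancelˡ-≡ _ _ 2 (trans 2s≡ (solve (a ∷ r ∷ []))) ,
  *-cancelˡ-≡ _ _ 2 (trans 2t≡ (solve (b ∷ r ∷ [])))
... | e@(suc _) , x , y , X , Y , 2s≡ , 2t≡ =
  contradiction (*-cancelˡ-≤ 2 2r+2s≤2t) (<⇒≱ t<r+s)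
  where
  open ≤-Reasoning
  2r+2s≤2t : 2 * (r + s) ≤ 2 * t
  2r+2s≤2t = begin
    2 * (r + s)              ≡⟨ *-distribˡ-+ 2 r s ⟩
    2 * r + 2 * s            ≡⟨ cong (2 * r +_) 2s≡ ⟩
    2 * r + (a * y + r * x)  ≤⟨ noTriangle 0<a a<b 4≤r (s≤s z≤n) R X Y ⟩
    b * x + r * y            ≡⟨ 2t≡ ⟨
    2 * t                    ∎

-- Passage between triangles and factorisations

^2⇒isRoot : ∀ {a b r} → r ^ 2 ≡ a * b + 4 → IsRoot a b r
^2⇒isRoot {r = r} eq = isRoot (trans (cong (r *_) (sym (*-identityʳ r))) eq)

isRoot⇒^2 : ∀ {a b r} → IsRoot a b r → r ^ 2 ≡ a * b + 4
isRoot⇒^2 {r = r} R = trans (cong (r *_) (*-identityʳ r)) (squared R)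

-- Adding a(a + 2r) to both sides of r² = ab + 4 completes the square on the left.
isRoot-extension : ∀ {a r} b → IsRoot a b r → IsRoot a (a + b + 2 * r) (r + a)
isRoot-extension {a} {r} b R = isRoot (combine-≡ (squared R) (solve (a ∷ b ∷ r ∷ [])))

isRoot-injectiveʳ : ∀ {a c d s} → 0 < a → IsRoot a c s → IsRoot a d s → c ≡ d
isRoot-injectiveʳ {suc a} {c} {d} _ S S′ =
  *-cancelˡ-≡ c d (suc a) (+-cancelʳ-≡ 4 _ _ (trans (sym (squared S)) (squared S′)))

d4Triple : ∀ {a b c r s t} → 0 < a → a < b → b < c →
  IsRoot a b r → IsRoot a c s → IsRoot b c t → IsD4Triple ⟦ a , b , c ⟧
d4Triple {a} {b} {c} {r} {s} {t} 0<a a<b b<c R S T = record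
  { threeElements = a , b , c , <⇒≢ a<b , <⇒≢ (<-trans a<b b<c) , <⇒≢ b<c , id , id
  ; positive = λ where
      _ (inj₁ refl)        → 0<a
      _ (inj₂ (inj₁ refl)) → <-trans 0<a a<b
      _ (inj₂ (inj₂ refl)) → <-trans 0<a (<-trans a<b b<c)
  ; square = λ where
      _ _ (inj₁ refl)        (inj₁ refl)        a≢a → contradiction refl a≢a
      _ _ (inj₁ refl)        (inj₂ (inj₁ refl)) _   → r , isRoot⇒^2 R
      _ _ (inj₁ refl)        (inj₂ (inj₂ refl)) _   → s , isRoot⇒^2 S
      _ _ (inj₂ (inj₁ refl)) (inj₁ refl)        _   → r , isRoot⇒^2 (isRoot-comm R)
      _ _ (inj₂ (inj₁ refl)) (inj₂ (inj₁ refl)) b≢b → contradiction refl b≢b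
      _ _ (inj₂ (inj₁ refl)) (inj₂ (inj₂ refl)) _   → t , isRoot⇒^2 T
      _ _ (inj₂ (inj₂ refl)) (inj₁ refl)        _   → s , isRoot⇒^2 (isRoot-comm S)
      _ _ (inj₂ (inj₂ refl)) (inj₂ (inj₁ refl)) _   → t , isRoot⇒^2 (isRoot-comm T)
      _ _ (inj₂ (inj₂ refl)) (inj₂ (inj₂ refl)) c≢c → contradiction refl c≢c
  }

admissible⇒isRoot : ∀ {r a b} → 4 ≤ r → IsAdmissible r a b → IsRoot a b r
admissible⇒isRoot 4≤r adm = ^2⇒isRoot
  -- The truncated subtraction is exact, since 4 ≤ 4 + 12 = 4² ≤ r².
  (trans (sym (m∸n+n≡m (≤-trans (m≤m+n 4 12) (^-monoˡ-≤ 2 4≤r))))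
         (cong (_+ 4) (IsAdmissible.factorisation adm)))

admissible⇒triangle : ∀ {r a b} → 4 ≤ r → IsAdmissible r a b →
  HasAssociatedTriangle ⟦ a , b , a + b + 2 * r ⟧ r (r + a) (r + b)
admissible⇒triangle {r} {a} {b} 4≤r adm = record
  { isD4Triple = d4Triple 0<a a<b b<c R S T
  ; elements   = id , id
  ; a<b        = a<b
  ; b<c        = b<c
  ; r-root     = isRoot⇒^2 R
  ; s-root     = isRoot⇒^2 S
  ; t-root     = isRoot⇒^2 T
  -- The inequality t < r + s reads r + b < r + (r + a), which is b - a < r.
  ; triangle   = +-monoʳ-< r (subst (_< r + a) (m∸n+n≡m (<⇒≤ a<b)) (+-monoˡ-< a b-a<r))
  }
  where
  open IsAdmissible adm
  R = admissible⇒isRoot 4≤r adm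
  S = isRoot-extension b R
  T = subst (λ n → IsRoot b (n + 2 * r) (r + b)) (+-comm b a) (isRoot-extension a (isRoot-comm R))
  b<c : b < a + b + 2 * r
  b<c = <-≤-trans (m<n+m b 0<a) (m≤m+n (a + b) (2 * r))

module _ {D r s t} (4≤r : 4 ≤ r) (tri : HasAssociatedTriangle D r s t) where
  open HasAssociatedTriangle tri

  private
    0<a : 0 < a
    0<a = IsD4Triple.positive isD4Triple a (proj₂ elements (inj₁ refl))
    R : IsRoot a b r
    R = ^2⇒isRoot r-root

  triangle⇒sides : s ≡ r + a × t ≡ r + b
  triangle⇒sides = triangle-sides 0<a a<b b<c 4≤r R (^2⇒isRoot s-root) (^2⇒isRoot t-root) triangle

  triangle⇒admissible : IsAdmissible r a b
  triangle⇒admissible = record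
    { factorisation = trans (cong (_∸ 4) r-root) (m+n∸n≡m (a * b) 4)
    ; 0<a           = 0<a
    ; a<b           = a<b
    ; b-a<r         = m<n+o⇒m∸n<o b a {{>-nonZero (≤-trans (s≤s z≤n) 4≤r)}} b<a+r
    }
    where
    b<a+r : b < a + r
    b<a+r = +-cancelˡ-< r b (a + r) (subst₂ _<_ (proj₂ triangle⇒sides)
      (cong (r +_) (trans (proj₁ triangle⇒sides) (+-comm r a))) triangle)

  -- Both c and a + b + 2r satisfy the equation s² = ac + 4, which determines c because a > 0.
  triangle⇒elements : D ≐ ⟦ a , b , a + b + 2 * r ⟧
  triangle⇒elements = subst (λ c → D ≐ ⟦ a , b , c ⟧)
    (isRoot-injectiveʳ 0<a (^2⇒isRoot s-root)
      (subst (IsRoot a (a + b + 2 * r)) (sym (proj₁ triangle⇒sides)) (isRoot-extension b R)))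
    elements

corollary4p2 : (r : ℕ) → 4 ≤ r →
    (∀ s t → IsSideLengthTriple r s t ⇔
    (∃[ a ] ∃[ b ] (IsAdmissible r a b × s ≡ r + a × t ≡ r + b)))
    × (∀ a b → IsAdmissible r a b →
    HasAssociatedTriangle ⟦ a , b , a + b + 2 * r ⟧ r (r + a) (r + b)
    × (∀ (D : Pred ℕ 0ℓ) → HasAssociatedTriangle D r (r + a) (r + b) →
    D ≐ ⟦ a , b , a + b + 2 * r ⟧))
corollary4p2 r 4≤r = (λ s t → mk⇔ (to s t) (from s t)) , λ a b adm →
    admissible⇒triangle 4≤r adm , unique a b
  where
  to : ∀ s t → IsSideLengthTriple r s t →
    ∃[ a ] ∃[ b ] (IsAdmissible r a b × s ≡ r + a × t ≡ r + b)
  to s t (D , tri) = _ , _ , triangle⇒admissible 4≤r tri , triangle⇒sides 4≤r tri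
  from : ∀ s t → ∃[ a ] ∃[ b ] (IsAdmissible r a b × s ≡ r + a × t ≡ r + b) →
    IsSideLengthTriple r s t
  from _ _ (a , b , adm , refl , refl) = _ , admissible⇒triangle 4≤r adm
  unique : ∀ a b D → HasAssociatedTriangle D r (r + a) (r + b) → D ≐ ⟦ a , b , a + b + 2 * r ⟧
  unique a b D tri
    with ra≡ , rb≡ ← triangle⇒sides 4≤r tri
    -- The sides exceed r by the two smaller elements of `D`, so these are the given a and b.
    with refl ← +-cancelˡ-≡ r a _ ra≡ | refl ← +-cancelˡ-≡ r b _ rb≡ =
    triangle⇒elements 4≤r tri
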